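{- Let $H$ be a graph. The class of $H$-free bipartite graphs is ivc-identical if and only if $H$ is (isomorphic to) an induced subgraph of $K_{1,3}^+$ or of $2P_1+P_3$.
   Context: Graphs are finite, simple and undirected. A graph is $H$-free if it has no induced subgraph isomorphic to $H$. $G+H$ is the disjoint union and $rG$ is the disjoint union of $r$ copies of $G$. $P_n$ is the path on $n$ vertices. $K_{1,3}$ is the star with $3$ leaves, and $K_{1,3}^+$ is the graph obtained from $K_{1,3}$ by subdividing one edge once. A vertex cover of $G$ is a set $S\subseteq V(G)$ such that $G-S$ has no edges. A graph has an independent vertex cover (a vertex cover that is an independent set) if and only if it is bipartite. For a bipartite graph $G$, $\mathrm{vc}(G)$ is the minimum size of a vertex cover and $\mathrm{ivc}(G)$ is the minimum size of an independent vertex cover. A class $\mathcal X$ of bipartite graphs is ivc-identical if $\mathrm{ivc}(G)=\mathrm{vc}(G)$ for every $G\in\mathcal X$. -}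

module Defs where

open import Data.Bool.Base using (Bool; true; false; T; not; _∧_; _∨_)
open import Data.Bool.Properties using (∧-comm; ∨-comm; T?)
open import Data.Fin.Base using (Fin; zero; suc; toℕ; splitAt)
open import Data.Fin.Properties using (all?) renaming (_≟_ to _≟ᶠ_)
open import Data.Fin.Subset using (Subset; _∈_; _∉_; ∣_∣; ∁; ⊤)
open import Data.Fin.Subset.Properties using (_∈?_; anySubset?; ∈⊤; x∉p⇒x∈∁p)
open import Data.Nat.Base using (ℕ; zero; suc; _+_; _≤_; z≤n; s≤s; _≡ᵇ_)
open import Data.Nat.Properties using () renaming (_≟_ to _≟ⁿ_)
open import Data.Product.Base using (∃; _×_; _,_; proj₁)
open import Data.Sum.Base using (_⊎_; inj₁; inj₂)
open import Function.Definitions using (Injective)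
open import Level using (0ℓ)
open import Relation.Binary.PropositionalEquality using (_≡_; refl; cong₂)
open import Relation.Nullary using (¬_; yes; no; does; contradiction)
open import Relation.Nullary.Decidable using (_×-dec_; _→-dec_; ¬?)
open import Relation.Unary using (Pred; Decidable)

record Graph : Set where
  field
    order      : ℕ
    adj        : Fin order → Fin order → Bool
    adj-sym    : ∀ u v → adj u v ≡ adj v u
    adj-irrefl : ∀ v → adj v v ≡ false

  Vertex : Set
  Vertex = Fin order

  infix 4 _~_
  _~_ : Vertex → Vertex → Set
  u ~ v = T (adj u v)

  -- G - S has no edges.
  VertexCover : Pred (Subset order) 0ℓ
  VertexCover S = ∀ u v → u ∉ S → v ∉ S → ¬ (u ~ v)

  Independent : Pred (Subset order) 0ℓ
  Independent S = ∀ u v → u ∈ S → v ∈ S → ¬ (u ~ v)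

  IndependentVertexCover : Pred (Subset order) 0ℓ
  IndependentVertexCover S = Independent S × VertexCover S

  vertexCover? : Decidable VertexCover
  vertexCover? S = all? λ u → all? λ v →
    ¬? (u ∈? S) →-dec (¬? (v ∈? S) →-dec ¬? (T? (adj u v)))

  independent? : Decidable Independent
  independent? S = all? λ u → all? λ v →
    (u ∈? S) →-dec ((v ∈? S) →-dec ¬? (T? (adj u v)))

  independentVertexCover? : Decidable IndependentVertexCover
  independentVertexCover? S = independent? S ×-dec vertexCover? S

open Graph

-- H is isomorphic to the subgraph of G induced by the image of f.
infix 4 _≼_
_≼_ : Graph → Graph → Set
H ≼ G = ∃ λ (f : Vertex H → Vertex G) →
  Injective _≡_ _≡_ f × (∀ u v → adj G (f u) (f v) ≡ adj H u v)

Free : Graph → Pred Graph 0ℓ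
Free H G = ¬ (H ≼ G)

IsMinSize : ∀ {n} → Pred (Subset n) 0ℓ → Pred ℕ 0ℓ
IsMinSize Q k = (∃ λ S → Q S × ∣ S ∣ ≡ k) × (∀ S → Q S → k ≤ ∣ S ∣)

private
  least : {P : Pred ℕ 0ℓ} → Decidable P → ∀ n → P n →
          ∃ λ k → P k × (∀ m → P m → k ≤ m)
  least P? zero    p = zero , p , λ _ _ → z≤n
  least P? (suc n) p with P? zero
  ... | yes p₀ = zero , p₀ , λ _ _ → z≤n
  ... | no ¬p₀ with least (λ m → P? (suc m)) n p
  ...   | k , pk , min = suc k , pk , λ where
          zero    p₀ → contradiction p₀ ¬p₀
          (suc m) pm → s≤s (min m pm)

minSize : ∀ {n} {Q : Pred (Subset n) 0ℓ} → Decidable Q → ∃ Q →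
          ∃ (IsMinSize Q)
minSize Q? (S , q)
  with least (λ k → anySubset? λ S → Q? S ×-dec (∣ S ∣ ≟ⁿ k))
             ∣ S ∣ (S , q , refl)
... | k , attained , min = k , attained , λ S q → min ∣ S ∣ (S , q , refl)

Bipartite : Pred Graph 0ℓ
Bipartite G = ∃ λ A → Independent G A × Independent G (∁ A)

BipartiteGraph : Set
BipartiteGraph = ∃ Bipartite

minVertexCover : (G : Graph) → ∃ (IsMinSize (VertexCover G))
minVertexCover G = minSize (vertexCover? G)
  (⊤ , λ u v u∉⊤ → contradiction ∈⊤ u∉⊤)

minIndependentVertexCover : ((G , _) : BipartiteGraph) →
                            ∃ (IsMinSize (IndependentVertexCover G))
minIndependentVertexCover (G , A , indA , ind∁A) =
  minSize (independentVertexCover? G)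
    (A , indA , λ u v u∉A v∉A → ind∁A u v (x∉p⇒x∈∁p u∉A) (x∉p⇒x∈∁p v∉A))

vc : BipartiteGraph → ℕ
vc (G , _) = proj₁ (minVertexCover G)

-- The minimum size does not depend on the bipartition supplied; the latter
-- only witnesses that an independent vertex cover exists.
ivc : BipartiteGraph → ℕ
ivc G = proj₁ (minIndependentVertexCover G)

IVCIdentical : Pred BipartiteGraph 0ℓ → Set
IVCIdentical 𝒳 = ∀ G → 𝒳 G → ivc G ≡ vc G

FreeBipartite : Graph → Pred BipartiteGraph 0ℓ
FreeBipartite H (G , _) = Free H G

P : ℕ → Graph
P n = record
  { order      = n
  ; adj        = λ i j → next (toℕ i) (toℕ j) ∨ next (toℕ j) (toℕ i)
  ; adj-sym    = λ i j → ∨-comm (next (toℕ i) (toℕ j)) _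
  ; adj-irrefl = λ i → cong₂ _∨_ (next-irrefl (toℕ i)) (next-irrefl (toℕ i))
  }
  where
  next : ℕ → ℕ → Bool
  next i j = suc i ≡ᵇ j

  next-irrefl : ∀ i → next i i ≡ false
  next-irrefl zero    = refl
  next-irrefl (suc i) = next-irrefl i

-- The star K_{1,k}, with centre zero.
K₁ : ℕ → Graph
K₁ k = record
  { order      = suc k
  ; adj        = e
  ; adj-sym    = λ { zero zero → refl ; zero (suc _) → refl
                   ; (suc _) zero → refl ; (suc _) (suc _) → refl }
  ; adj-irrefl = λ { zero → refl ; (suc _) → refl }
  }
  where
  e : Fin (suc k) → Fin (suc k) → Bool
  e zero    zero    = false
  e zero    (suc _) = true
  e (suc _) zero    = true
  e (suc _) (suc _) = false

infixl 6 _⊕_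
infixr 7 _·_

-- Disjoint union.
_⊕_ : Graph → Graph → Graph
G ⊕ H = record
  { order      = order G + order H
  ; adj        = λ u v → e (splitAt (order G) u) (splitAt (order G) v)
  ; adj-sym    = λ u v → e-sym (splitAt (order G) u) (splitAt (order G) v)
  ; adj-irrefl = λ v → e-irrefl (splitAt (order G) v)
  }
  where
  e : Vertex G ⊎ Vertex H → Vertex G ⊎ Vertex H → Bool
  e (inj₁ u) (inj₁ v) = adj G u v
  e (inj₂ u) (inj₂ v) = adj H u v
  e _        _        = false

  e-sym : ∀ u v → e u v ≡ e v u
  e-sym (inj₁ u) (inj₁ v) = adj-sym G u v
  e-sym (inj₁ _) (inj₂ _) = refl
  e-sym (inj₂ _) (inj₁ _) = refl
  e-sym (inj₂ u) (inj₂ v) = adj-sym H u v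

  e-irrefl : ∀ v → e v v ≡ false
  e-irrefl (inj₁ v) = adj-irrefl G v
  e-irrefl (inj₂ v) = adj-irrefl H v

-- Disjoint union of r copies; P 0 is the graph without vertices.
_·_ : ℕ → Graph → Graph
zero  · G = P 0
suc r · G = G ⊕ r · G

-- Replaces the edge ab by a path of length two through the new vertex zero.
subdivide : (G : Graph) (a b : Vertex G) → _~_ G a b → Graph
subdivide G a b _ = record
  { order      = suc (order G)
  ; adj        = e
  ; adj-sym    = e-sym
  ; adj-irrefl = e-irrefl
  }
  where
  end : Vertex G → Bool
  end x = does (x ≟ᶠ a) ∨ does (x ≟ᶠ b)

  -- As adj G x x is false, removing all pairs of ends of ab from the edge
  -- relation removes the edge ab only.
  e : Fin (suc (order G)) → Fin (suc (order G)) → Bool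
  e zero    zero    = false
  e zero    (suc y) = end y
  e (suc x) zero    = end x
  e (suc x) (suc y) = adj G x y ∧ not (end x ∧ end y)

  e-sym : ∀ x y → e x y ≡ e y x
  e-sym zero    zero    = refl
  e-sym zero    (suc y) = refl
  e-sym (suc x) zero    = refl
  e-sym (suc x) (suc y)
    rewrite adj-sym G x y | ∧-comm (end x) (end y) = refl

  e-irrefl : ∀ x → e x x ≡ false
  e-irrefl zero    = refl
  e-irrefl (suc x) rewrite adj-irrefl G x = refl

K₁,₃⁺ : Graph
K₁,₃⁺ = subdivide (K₁ 3) zero (suc zero) _

{-# OPTIONS --safe #-}
-- If H-free bipartite graphs are ivc-identical, then H is an induced subgraph
-- of every bipartite graph with vc < ivc.  The smallest one is the double star
-- with two leaves at either centre, whose vertex-deleted subgraphs are exactly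
-- K₁,₃⁺ and 2P₁ + P₃.  The double star itself is ruled out by stretching its
-- central edge to a path of length three: this again gives vc < ivc, but there
-- vertices of degree three are never adjacent.
--
-- Conversely, let A be a colour class and S a vertex cover.  If S contains an
-- edge uv with u ∈ A, then v can be deleted from S unless it has a neighbour b
-- outside S, and u can be exchanged for its neighbour outside S unless it has
-- two of them, a and a′.  When neither is possible, v, u, b, a, a′ induce
-- K₁,₃⁺, and together with any two vertices of A outside S the path a u a′
-- induces 2P₁ + P₃; if there are no two such vertices then |A| ≤ |S|.
module Submission where

open import Defs
open import Data.Bool.Base using (Bool; true; false; T)
open import Data.Bool.Properties using (T?; T-≡) renaming (_≟_ to _≟ᵇ_)
open import Data.Fin.Base using (Fin; zero; suc; Fin′; inject; fromℕ<; _<_)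
open import Data.Fin.Patterns
open import Data.Fin.Properties
  using (_≟_; any?; all?; <-cmp; toℕ-injective; toℕ-inject; toℕ-fromℕ<)
open import Data.Fin.Subset
open import Data.Fin.Subset.Properties
open import Data.Nat.Base as ℕ using (ℕ; zero; suc; _+_; z≤n; s≤s)
open import Data.Nat.Induction using (<-wellFounded)
import Data.Nat.Properties as ℕ
open import Data.Product.Base using (∃; ∃₂; ∃-syntax; _×_; _,_; proj₁; proj₂)
open import Data.Sum.Base using (_⊎_; inj₁; inj₂; [_,_]′; map)
open import Data.Vec.Base using ([]; _∷_; there; lookup)
import Data.Vec.Functional as F
open import Function.Base using (_∘_)
open import Function.Bundles using (_⇔_; mk⇔; Equivalence)
open import Function.Definitions using (Injective)
open import Induction.WellFounded using (Acc; acc)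
open import Level using (0ℓ)
open import Relation.Binary.Definitions using (tri<; tri≈; tri>)
open import Relation.Binary.PropositionalEquality
  using (_≡_; _≢_; _≗_; refl; sym; trans; cong; cong₂; subst; ≢-sym)
open import Relation.Nullary using (¬_; Dec; yes; no; does; contradiction)
open import Relation.Nullary.Decidable
  using (_×-dec_; _→-dec_; ¬?; map′; from-yes; from-no; decidable-stable)
open import Relation.Unary using (Pred; Decidable)

open Graph

private
  variable
    m n : ℕ

-- Finite sets

¬T⇒≡false : ∀ {b} → ¬ T b → b ≡ false
¬T⇒≡false {false} _  = refl
¬T⇒≡false {true}  ¬t = contradiction _ ¬t

∈∉⇒≢ : ∀ {p : Subset n} {x y} → x ∈ p → y ∉ p → x ≢ y
∈∉⇒≢ x∈p y∉p refl = y∉p x∈p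

x∉p-x : ∀ (p : Subset n) x → x ∉ p - x
x∉p-x (_ ∷ _) zero    ()
x∉p-x (_ ∷ p) (suc x) (there x∈) = x∉p-x p x x∈

∣p∪q∣≤∣p∣+∣q∣ : ∀ (p q : Subset n) → ∣ p ∪ q ∣ ℕ.≤ ∣ p ∣ + ∣ q ∣
∣p∪q∣≤∣p∣+∣q∣ []            []            = z≤n
∣p∪q∣≤∣p∣+∣q∣ (outside ∷ p) (outside ∷ q) = ∣p∪q∣≤∣p∣+∣q∣ p q
∣p∪q∣≤∣p∣+∣q∣ (outside ∷ p) (inside  ∷ q)
  rewrite ℕ.+-suc ∣ p ∣ ∣ q ∣ = s≤s (∣p∪q∣≤∣p∣+∣q∣ p q)
∣p∪q∣≤∣p∣+∣q∣ (inside  ∷ p) (outside ∷ q) = s≤s (∣p∪q∣≤∣p∣+∣q∣ p q)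
∣p∪q∣≤∣p∣+∣q∣ (inside  ∷ p) (inside  ∷ q) =
  s≤s (ℕ.≤-trans (∣p∪q∣≤∣p∣+∣q∣ p q) (ℕ.+-monoʳ-≤ ∣ p ∣ (ℕ.n≤1+n _)))

infixl 5 _-_+ₑ_
_-_+ₑ_ : Subset n → Fin n → Fin n → Subset n
p - x +ₑ y = (p - x) ∪ ⁅ y ⁆

module _ {p : Subset n} {x : Fin n} where

  ∣p-x+y∣≤∣p∣ : x ∈ p → ∀ y → ∣ p - x +ₑ y ∣ ℕ.≤ ∣ p ∣
  ∣p-x+y∣≤∣p∣ x∈p y = begin
    ∣ (p - x) ∪ ⁅ y ⁆ ∣   ≤⟨ ∣p∪q∣≤∣p∣+∣q∣ (p - x) ⁅ y ⁆ ⟩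
    ∣ p - x ∣ + ∣ ⁅ y ⁆ ∣ ≡⟨ cong (∣ p - x ∣ +_) (∣⁅x⁆∣≡1 y) ⟩
    ∣ p - x ∣ + 1         ≡⟨ ℕ.+-comm _ 1 ⟩
    suc ∣ p - x ∣         ≤⟨ x∈p⇒∣p-x∣<∣p∣ x∈p ⟩
    ∣ p ∣                 ∎
    where open ℕ.≤-Reasoning

  z∈p-x+y : ∀ {y z} → z ∈ p → z ≢ x → z ∈ p - x +ₑ y
  z∈p-x+y z∈p z≢x = x∈p∪q⁺ (inj₁ (x∈p∧x≢y⇒x∈p-y z∈p z≢x))

  y∈p-x+y : ∀ y → y ∈ p - x +ₑ y
  y∈p-x+y y = x∈p∪q⁺ (inj₂ (x∈⁅x⁆ y))

  z∈p-x+y⁻ : ∀ {y z} → z ∈ p - x +ₑ y → (z ∈ p × z ≢ x) ⊎ z ≡ y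
  z∈p-x+y⁻ {y} z∈ with x∈p∪q⁻ (p - x) ⁅ y ⁆ z∈
  ... | inj₁ z∈p-x = inj₁ (p─q⊆p p ⁅ x ⁆ z∈p-x , λ { refl → x∉p-x p x z∈p-x })
  ... | inj₂ z∈⁅y⁆ = inj₂ (x∈⁅y⁆⇒x≡y y z∈⁅y⁆)

inject-fromℕ< : ∀ {i j : Fin n} (i<j : i < j) → inject {i = j} (fromℕ< i<j) ≡ i
inject-fromℕ< i<j =
  toℕ-injective (trans (toℕ-inject (fromℕ< i<j)) (toℕ-fromℕ< i<j))

Two : Pred (Fin n) 0ℓ → Set
Two Q = ∃₂ λ x y → Q x × Q y × x ≢ y

-- One `w` serves both when `Q` has exactly one element and when it has none; in the latter case it
-- is the default `d`. The two cases can then be treated alike.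
two⊎subsingleton : {Q : Pred (Fin n) 0ℓ} → Decidable Q → (d : Fin n) →
                   Two Q ⊎ ∃[ w ] (w ≡ d ⊎ Q w) × (∀ x → Q x → x ≡ w)
two⊎subsingleton Q? d with any? Q?
... | no ¬∃Q = inj₂ (d , inj₁ refl , λ x qx → contradiction (x , qx) ¬∃Q)
... | yes (w , qw) with any? (λ x → Q? x ×-dec ¬? (x ≟ w))
...   | yes (x , qx , x≢w) = inj₁ (x , w , qx , qw , x≢w)
...   | no ¬∃x = inj₂ (w , inj₂ qw , λ x qx →
          decidable-stable (x ≟ w) (λ x≢w → ¬∃x (x , qx , x≢w)))

-- Induction on the size of the domain. Functions are rebuilt from their values, which preserves
-- them only up to `_≗_`, so `Q` has to respect it.
anyFunction? : {Q : Pred (Fin m → Fin n) 0ℓ} →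
               (∀ {f g} → f ≗ g → Q f → Q g) → Decidable Q → Dec (∃ Q)
anyFunction? {zero} resp Q? = map′ (_ ,_) (λ (f , q) → resp (λ ()) q) (Q? λ ())
anyFunction? {suc m} {Q = Q} resp Q? =
  map′ (λ (x , f , q) → x F.∷ f , q)
       (λ (f , q) → f zero , f ∘ suc , resp (λ { zero → refl ; (suc _) → refl }) q)
       (any? λ x → anyFunction? (resp ∘ ∷-cong x) λ f → Q? (x F.∷ f))
  where
  ∷-cong : ∀ x {f g : Fin m → Fin _} → f ≗ g → x F.∷ f ≗ x F.∷ g
  ∷-cong x f≗g zero    = refl
  ∷-cong x f≗g (suc i) = f≗g i

-- Induced subgraphs

≼-trans : ∀ G H K → G ≼ H → H ≼ K → G ≼ K
≼-trans G H K (f , f-inj , f-adj) (g , g-inj , g-adj) =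
  g ∘ f , f-inj ∘ g-inj , λ u v → trans (g-adj (f u) (f v)) (f-adj u v)

infix 4 _≼?_
-- Decidability turns a refutation of `Free H G` into an actual embedding, as the necessity argument
-- requires.
_≼?_ : ∀ H G → Dec (H ≼ G)
H ≼? G = anyFunction? resp λ f →
  map′ (λ h → h _ _) (λ h _ _ → h)
    (all? λ u → all? λ v → (f u ≟ f v) →-dec (u ≟ v))
  ×-dec (all? λ u → all? λ v → adj G (f u) (f v) ≟ᵇ adj H u v)
  where
  resp : ∀ {f g : Vertex H → Vertex G} → f ≗ g →
         Injective _≡_ _≡_ f × (∀ u v → adj G (f u) (f v) ≡ adj H u v) →
         Injective _≡_ _≡_ g × (∀ u v → adj G (g u) (g v) ≡ adj H u v)
  resp f≗g (inj , adj-f) =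
    (λ {u} {v} gu≡gv → inj (trans (f≗g u) (trans gu≡gv (sym (f≗g v))))) ,
    λ u v → trans (cong₂ (adj G) (sym (f≗g u)) (sym (f≗g v))) (adj-f u v)

module _ (H G : Graph) (f : Vertex H → Vertex G) where

  -- Symmetry and irreflexivity of `adj` settle the remaining pairs. As `Fin′ j` ranges over the
  -- indices below `j`, a graph on five vertices leaves ten cases.
  ≼-fromPairs : (∀ j (i : Fin′ j) → f (inject i) ≢ f j ×
                  adj G (f (inject i)) (f j) ≡ adj H (inject i) j) →
                H ≼ G
  ≼-fromPairs pairs = f , injective , adj-f
    where
    pairs′ : ∀ {i j} → i < j → f i ≢ f j × adj G (f i) (f j) ≡ adj H i j
    pairs′ {i} {j} i<j =
      subst (λ i → f i ≢ f j × adj G (f i) (f j) ≡ adj H i j)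
            (inject-fromℕ< i<j) (pairs j (fromℕ< i<j))

    injective : Injective _≡_ _≡_ f
    injective {i} {j} fi≡fj with <-cmp i j
    ... | tri< i<j _ _ = contradiction fi≡fj (proj₁ (pairs′ i<j))
    ... | tri≈ _ i≡j _ = i≡j
    ... | tri> _ _ j<i = contradiction (sym fi≡fj) (proj₁ (pairs′ j<i))

    adj-f : ∀ i j → adj G (f i) (f j) ≡ adj H i j
    adj-f i j with <-cmp i j
    ... | tri< i<j _ _  = proj₂ (pairs′ i<j)
    ... | tri≈ _ refl _ = trans (adj-irrefl G (f i)) (sym (adj-irrefl H i))
    ... | tri> _ _ j<i  =
      trans (adj-sym G (f i) (f j)) (trans (proj₂ (pairs′ j<i)) (adj-sym H j i))

-- Making a vertex cover independent

module _ (G : Graph) {A : Subset (order G)}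
         (A-independent : Independent G A) (∁A-independent : Independent G (∁ A))
         where

  private
    V : Set
    V = Vertex G

    ~-sym : ∀ {u v} → _~_ G u v → _~_ G v u
    ~-sym {u} {v} = subst T (adj-sym G u v)

    ~-irrefl : ∀ {v} → ¬ _~_ G v v
    ~-irrefl {v} = subst T (adj-irrefl G v)

    ~⇒∉ : ∀ {u v} → u ∈ A → _~_ G u v → v ∉ A
    ~⇒∉ u∈A u~v v∈A = A-independent _ _ u∈A v∈A u~v

    ~⇒∈ : ∀ {u v} → u ∉ A → _~_ G u v → v ∈ A
    ~⇒∈ {v = v} u∉A u~v = decidable-stable (v ∈? A) λ v∉A →
      ∁A-independent _ _ (x∉p⇒x∈∁p u∉A) (x∉p⇒x∈∁p v∉A) u~v

    edge : ∀ {u v} → _~_ G u v → adj G u v ≡ true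
    edge = Equivalence.to T-≡

    nonedge-∈ : ∀ {u v} → u ∈ A → v ∈ A → adj G u v ≡ false
    nonedge-∈ u∈A v∈A = ¬T⇒≡false (A-independent _ _ u∈A v∈A)

    nonedge-∉ : ∀ {u v} → u ∉ A → v ∉ A → adj G u v ≡ false
    nonedge-∉ u∉A v∉A = ¬T⇒≡false λ u~v → v∉A (~⇒∈ u∉A u~v)

  -- Edges at `u` are covered by their other end, all other edges by what is kept of `S`. This
  -- serves deletions and exchanges alike.
  replace-cover : ∀ {S S′ u} → VertexCover G S →
                  (∀ {x} → x ∈ S → x ≢ u → x ∈ S′) →
                  (∀ {x} → _~_ G u x → x ∈ S′) → VertexCover G S′
  replace-cover {S} {S′} {u} cover keep N[u]⊆S′ x y x∉S′ y∉S′ x~y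
    with x ≟ u | y ≟ u
  ... | yes refl | _        = y∉S′ (N[u]⊆S′ x~y)
  ... | no _     | yes refl = x∉S′ (N[u]⊆S′ (~-sym x~y))
  ... | no x≢u   | no y≢u   =
    cover x y (λ x∈S → x∉S′ (keep x∈S x≢u)) (λ y∈S → y∉S′ (keep y∈S y≢u)) x~y

  OutsideNeighbour : Subset (order G) → V → Pred V 0ℓ
  OutsideNeighbour S u x = _~_ G u x × x ∉ S

  outsideNeighbour? : ∀ S u → Decidable (OutsideNeighbour S u)
  outsideNeighbour? S u x = T? (adj G u x) ×-dec ¬? (x ∈? S)

  module _ {S : Subset (order G)} (cover : VertexCover G S) where

    private
      nonedge-∉S : ∀ {u v} → u ∉ S → v ∉ S → adj G u v ≡ false
      nonedge-∉S u∉S v∉S = ¬T⇒≡false (cover _ _ u∉S v∉S)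

    -- In K₁,₃⁺ the subdividing vertex is 0F, the centre 1F, and 2F the leaf
    -- adjacent to 0F.
    claw⁺ : ∀ {u v b} → u ∈ A → u ∈ S → v ∈ S → _~_ G u v →
            Two (OutsideNeighbour S u) → OutsideNeighbour S v b → K₁,₃⁺ ≼ G
    claw⁺ {u} {v} {b} u∈A u∈S v∈S u~v
          (a , a′ , (u~a , a∉S) , (u~a′ , a′∉S) , a≢a′) (v~b , b∉S) =
      ≼-fromPairs K₁,₃⁺ G (lookup (v ∷ u ∷ b ∷ a ∷ a′ ∷ [])) λ where
        0F ()
        1F 0F → ≢-sym (∈∉⇒≢ u∈A v∉A)   , edge (~-sym u~v)
        2F 0F → ∈∉⇒≢ v∈S b∉S           , edge v~b
        2F 1F → ∈∉⇒≢ u∈S b∉S           , nonedge-∈ u∈A b∈A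
        3F 0F → ∈∉⇒≢ v∈S a∉S           , nonedge-∉ v∉A a∉A
        3F 1F → ∈∉⇒≢ u∈S a∉S           , edge u~a
        3F 2F → ∈∉⇒≢ b∈A a∉A           , nonedge-∉S b∉S a∉S
        4F 0F → ∈∉⇒≢ v∈S a′∉S          , nonedge-∉ v∉A a′∉A
        4F 1F → ∈∉⇒≢ u∈S a′∉S          , edge u~a′
        4F 2F → ∈∉⇒≢ b∈A a′∉A          , nonedge-∉S b∉S a′∉S
        4F 3F → a≢a′                   , nonedge-∉ a∉A a′∉A
      where
      v∉A  = ~⇒∉ u∈A u~v
      a∉A  = ~⇒∉ u∈A u~a
      a′∉A = ~⇒∉ u∈A u~a′
      b∈A  = ~⇒∈ v∉A v~b

    -- `a`, `u`, `a′` form the path, and `b`, `b′` are isolated. Each nonedge joins two vertices of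
    -- one colour class or two vertices outside the cover.
    2P₁+P₃ : ∀ {u} → u ∈ A → u ∈ S → Two (OutsideNeighbour S u) →
             Two (λ x → x ∈ A × x ∉ S) → 2 · P 1 ⊕ P 3 ≼ G
    2P₁+P₃ {u} u∈A u∈S (a , a′ , (u~a , a∉S) , (u~a′ , a′∉S) , a≢a′)
           (b , b′ , (b∈A , b∉S) , (b′∈A , b′∉S) , b≢b′) =
      ≼-fromPairs (2 · P 1 ⊕ P 3) G (lookup (b ∷ b′ ∷ a ∷ u ∷ a′ ∷ [])) λ where
        0F ()
        1F 0F → b≢b′                   , nonedge-∈ b∈A b′∈A
        2F 0F → ∈∉⇒≢ b∈A a∉A           , nonedge-∉S b∉S a∉S
        2F 1F → ∈∉⇒≢ b′∈A a∉A          , nonedge-∉S b′∉S a∉S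
        3F 0F → ≢-sym (∈∉⇒≢ u∈S b∉S)   , nonedge-∈ b∈A u∈A
        3F 1F → ≢-sym (∈∉⇒≢ u∈S b′∉S)  , nonedge-∈ b′∈A u∈A
        3F 2F → ≢-sym (∈∉⇒≢ u∈A a∉A)   , edge (~-sym u~a)
        4F 0F → ∈∉⇒≢ b∈A a′∉A          , nonedge-∉S b∉S a′∉S
        4F 1F → ∈∉⇒≢ b′∈A a′∉A         , nonedge-∉S b′∉S a′∉S
        4F 2F → a≢a′                   , nonedge-∉ a∉A a′∉A
        4F 3F → ∈∉⇒≢ u∈A a′∉A          , edge u~a′
      where
      a∉A  = ~⇒∉ u∈A u~a
      a′∉A = ~⇒∉ u∈A u~a′

    innerEdge⊎independent :
      (∃₂ λ u v → u ∈ A × u ∈ S × v ∈ S × _~_ G u v) ⊎ Independent G S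
    innerEdge⊎independent
      with any? (λ u → any? λ v →
           (u ∈? A) ×-dec (u ∈? S) ×-dec (v ∈? S) ×-dec T? (adj G u v))
    ... | yes e = inj₁ e
    ... | no ¬e = inj₂ independent
      where
      independent : Independent G S
      independent u v u∈S v∈S u~v with u ∈? A
      ... | yes u∈A = ¬e (u , v , u∈A , u∈S , v∈S , u~v)
      -- Every edge has an end in `A`; here it is `v`, so the ends are swapped.
      ... | no  u∉A = ¬e (v , u , ~⇒∈ u∉A u~v , v∈S , u∈S , ~-sym u~v)

  -- Vertices of `S` in `A` count twice, so that the sum also drops when a vertex of `A` is
  -- exchanged for one outside `A` and the size of `S` stays the same.
  measure : Subset (order G) → ℕ
  measure S = ∣ S ∣ + ∣ S ∩ A ∣

  delete-measure : ∀ {S v} → v ∈ S → measure (S - v) ℕ.< measure S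
  delete-measure {S} {v} v∈S = ℕ.+-mono-<-≤ (x∈p⇒∣p-x∣<∣p∣ v∈S)
    (p⊆q⇒∣p∣≤∣q∣ λ x∈ → let x∈S-v , x∈A = x∈p∩q⁻ (S - v) A x∈ in
      x∈p∩q⁺ (p─q⊆p S ⁅ v ⁆ x∈S-v , x∈A))

  exchange-measure : ∀ {S u w} → u ∈ S → u ∈ A → w ∉ A →
                     measure (S - u +ₑ w) ℕ.< measure S
  exchange-measure {S} {u} {w} u∈S u∈A w∉A =
    ℕ.+-mono-≤-< (∣p-x+y∣≤∣p∣ u∈S w)
      (p⊂q⇒∣p∣<∣q∣ (proj₁ ∘ inner , u , x∈p∩q⁺ (u∈S , u∈A) , λ u∈ → proj₂ (inner u∈) refl))
    where
    inner : ∀ {x} → x ∈ (S - u +ₑ w) ∩ A → x ∈ S ∩ A × x ≢ u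
    inner x∈ with x∈S′ , x∈A ← x∈p∩q⁻ (S - u +ₑ w) A x∈ with z∈p-x+y⁻ x∈S′
    ... | inj₁ (x∈S , x≢u) = x∈p∩q⁺ (x∈S , x∈A) , x≢u
    ... | inj₂ refl        = contradiction x∈A w∉A

  independentCover : Free K₁,₃⁺ G ⊎ Free (2 · P 1 ⊕ P 3) G →
                     ∀ S → VertexCover G S →
                     ∃[ S′ ] IndependentVertexCover G S′ × ∣ S′ ∣ ℕ.≤ ∣ S ∣
  independentCover free S = go free S (<-wellFounded (measure S))
    where
    -- `free` is an argument again so that both cases share the exchange step and are split only
    -- after it.
    go : Free K₁,₃⁺ G ⊎ Free (2 · P 1 ⊕ P 3) G →
         ∀ S → Acc ℕ._<_ (measure S) → VertexCover G S →
         ∃[ S′ ] IndependentVertexCover G S′ × ∣ S′ ∣ ℕ.≤ ∣ S ∣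
    go free S (acc smaller) cover with innerEdge⊎independent cover
    ... | inj₂ independent = S , (independent , cover) , ℕ.≤-refl
    ... | inj₁ (u , v , u∈A , u∈S , v∈S , u~v)
      -- With no neighbour of `u` outside `S`, the default makes `w` equal to `v`, which is already
      -- in `S`; the exchange then merely deletes `u`. In either case `w` is a neighbour of `u`,
      -- hence outside `A`.
      with two⊎subsingleton (outsideNeighbour? S u) v
    ...   | inj₂ (w , w-origin , outside⇒≡w) =
      let S″ , S″-ivc , S″≤S′ =
            go free (S - u +ₑ w)
               (smaller (exchange-measure u∈S u∈A
                 ([ (λ { refl → ~⇒∉ u∈A u~v }) , ~⇒∉ u∈A ∘ proj₁ ]′ w-origin)))
               (replace-cover cover z∈p-x+y N[u]⊆)
      in S″ , S″-ivc , ℕ.≤-trans S″≤S′ (∣p-x+y∣≤∣p∣ u∈S w)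
      where
      N[u]⊆ : ∀ {x} → _~_ G u x → x ∈ S - u +ₑ w
      N[u]⊆ {x} u~x with x ∈? S
      ... | yes x∈S = z∈p-x+y x∈S λ { refl → ~-irrefl u~x }
      ... | no  x∉S with refl ← outside⇒≡w x (u~x , x∉S) = y∈p-x+y w
    go free@(inj₁ K₁,₃⁺⋠G) S (acc smaller) cover
      | inj₁ (u , v , u∈A , u∈S , v∈S , u~v) | inj₁ aa′
      with any? (outsideNeighbour? S v)
    ... | yes (b , b-out) =
      contradiction (claw⁺ cover u∈A u∈S v∈S u~v aa′ b-out) K₁,₃⁺⋠G
    ... | no ¬b =
      let S″ , S″-ivc , S″≤S′ =
            go free (S - v) (smaller (delete-measure v∈S))
               (replace-cover cover x∈p∧x≢y⇒x∈p-y N[v]⊆)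
      in S″ , S″-ivc , ℕ.≤-trans S″≤S′ (∣p─q∣≤∣p∣ S ⁅ v ⁆)
      where
      N[v]⊆ : ∀ {x} → _~_ G v x → x ∈ S - v
      N[v]⊆ {x} v~x = x∈p∧x≢y⇒x∈p-y
        (decidable-stable (x ∈? S) λ x∉S → ¬b (x , v~x , x∉S))
        λ { refl → ~-irrefl v~x }
    go (inj₂ 2P₁+P₃⋠G) S _ cover
      | inj₁ (u , v , u∈A , u∈S , v∈S , u~v) | inj₁ aa′
      with two⊎subsingleton (λ x → (x ∈? A) ×-dec ¬? (x ∈? S)) v
    ... | inj₁ bb′ = contradiction (2P₁+P₃ cover u∈A u∈S aa′ bb′) 2P₁+P₃⋠G
    -- At most `w` belongs to `A` but not to `S`, whereas `v` belongs to `S` but not to `A`. So the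
    -- cover `A` is no larger than `S`, and the recursion ends.
    ... | inj₂ (w , _ , outside⇒≡w) =
      A , (A-independent , λ x y x∉A y∉A x~y → y∉A (~⇒∈ x∉A x~y)) ,
      ℕ.≤-trans (p⊆q⇒∣p∣≤∣q∣ A⊆) (∣p-x+y∣≤∣p∣ v∈S w)
      where
      A⊆ : A ⊆ S - v +ₑ w
      A⊆ {x} x∈A with x ∈? S
      ... | yes x∈S = z∈p-x+y x∈S (∈∉⇒≢ x∈A (~⇒∉ u∈A u~v))
      ... | no  x∉S with refl ← outside⇒≡w x (x∈A , x∉S) = y∈p-x+y w

minSize-mono : ∀ {Q R : Pred (Subset n) 0ℓ} {k l} → IsMinSize Q k → IsMinSize R l →
               (∀ S → R S → ∃[ S′ ] Q S′ × ∣ S′ ∣ ℕ.≤ ∣ S ∣) → k ℕ.≤ l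
minSize-mono (_ , Q-min) ((S , rS , refl) , _) Q-below
  with S′ , qS′ , S′≤S ← Q-below S rS = ℕ.≤-trans (Q-min S′ qS′) S′≤S

ivc≡vc : ∀ G → Free K₁,₃⁺ (proj₁ G) ⊎ Free (2 · P 1 ⊕ P 3) (proj₁ G) →
         ivc G ≡ vc G
ivc≡vc 𝔾@(G , A , indA , ind∁A) free = ℕ.≤-antisym
  (minSize-mono ivc-min vc-min (independentCover G indA ind∁A free))
  (minSize-mono vc-min ivc-min λ I I-ivc → I , proj₂ I-ivc , ℕ.≤-refl)
  where
  vc-min  = proj₂ (minVertexCover G)
  ivc-min = proj₂ (minIndependentVertexCover 𝔾)

-- Two graphs with vc < ivc

-- The new leaf is zero.
pendant : (G : Graph) → Vertex G → Graph
pendant G v = record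
  { order      = suc (order G)
  ; adj        = e
  ; adj-sym    = λ { zero zero → refl ; zero (suc _) → refl
                   ; (suc _) zero → refl ; (suc x) (suc y) → adj-sym G x y }
  ; adj-irrefl = λ { zero → refl ; (suc x) → adj-irrefl G x }
  }
  where
  e : Fin (suc (order G)) → Fin (suc (order G)) → Bool
  e zero    zero    = false
  e zero    (suc y) = does (y ≟ v)
  e (suc x) zero    = does (x ≟ v)
  e (suc x) (suc y) = adj G x y

-- The centres are 3F and 4F, with leaves 1F, 2F and 0F, 5F.
doubleStar : Graph
doubleStar = pendant (pendant (P 4) 1F) 3F

-- The branch vertices are 3F and 6F, with leaves 1F, 2F and 0F, 7F.
stretchedDoubleStar : Graph
stretchedDoubleStar = pendant (pendant (P 6) 1F) 5F

bipartite? : ∀ G A → Dec (Independent G A × Independent G (∁ A))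
bipartite? G A = independent? G A ×-dec independent? G (∁ A)

doubleStarᵇ : BipartiteGraph
doubleStarᵇ = doubleStar , A , from-yes (bipartite? doubleStar A)
  where
  A : Subset 6
  A = inside ∷ outside ∷ outside ∷ inside ∷ outside ∷ inside ∷ []

stretchedDoubleStarᵇ : BipartiteGraph
stretchedDoubleStarᵇ =
  stretchedDoubleStar , A , from-yes (bipartite? stretchedDoubleStar A)
  where
  A : Subset 8
  A = inside ∷ outside ∷ outside ∷ inside ∷ outside ∷ inside ∷ outside ∷ inside ∷ []

smallIVC? : ∀ G k → Dec (∃[ I ] ∣ I ∣ ℕ.≤ k × IndependentVertexCover G I)
smallIVC? G k = anySubset? λ I → (∣ I ∣ ℕ.≤? k) ×-dec independentVertexCover? G I

-- `S` bounds `vc` from above, so equality would make a minimum independent cover one of size at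
-- most that of `S`. Neither minimum has to be computed.
ivc≢vc : ∀ G S → VertexCover (proj₁ G) S →
         ¬ (∃[ I ] ∣ I ∣ ℕ.≤ ∣ S ∣ × IndependentVertexCover (proj₁ G) I) →
         ivc G ≢ vc G
ivc≢vc 𝔾@(G , _) S cover ¬small ivc≡vc
  with _ , vc-min ← proj₂ (minVertexCover G)
     | (I , I-ivc , ∣I∣≡ivc) , _ ← proj₂ (minIndependentVertexCover 𝔾) =
  ¬small (I , subst (ℕ._≤ ∣ S ∣) (sym (trans ∣I∣≡ivc ivc≡vc)) (vc-min S cover) , I-ivc)

-- The two centres cover every edge. As the graph is connected, its only independent covers are the
-- colour classes, each of size three.
doubleStar-ivc≢vc : ivc doubleStarᵇ ≢ vc doubleStarᵇ
doubleStar-ivc≢vc = ivc≢vc doubleStarᵇ S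
  (from-yes (vertexCover? doubleStar S)) (from-no (smallIVC? doubleStar 2))
  where
  S : Subset 6
  S = ⁅ 3F ⁆ ∪ ⁅ 4F ⁆

-- The branch vertices miss only the edge between `4F` and `5F`, so three vertices suffice; each
-- colour class has four.
stretchedDoubleStar-ivc≢vc : ivc stretchedDoubleStarᵇ ≢ vc stretchedDoubleStarᵇ
stretchedDoubleStar-ivc≢vc = ivc≢vc stretchedDoubleStarᵇ S
  (from-yes (vertexCover? stretchedDoubleStar S))
  (from-no (smallIVC? stretchedDoubleStar 3))
  where
  S : Subset 8
  S = ⁅ 3F ⁆ ∪ ⁅ 4F ⁆ ∪ ⁅ 6F ⁆

-- Adjacent vertices of degree at least three

BranchAlong : (G : Graph) → Vertex G → Vertex G → Set
BranchAlong G x y = ∃₂ λ a b →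
  _~_ G x a × a ≢ y × _~_ G x b × b ≢ y × a ≢ b

-- An edge whose ends both have degree at least three. Induced subgraphs pass this on to the larger
-- graph, which avoids a search through all maps between the two double stars.
BranchEdge : Pred Graph 0ℓ
BranchEdge G = ∃₂ λ x y → _~_ G x y × BranchAlong G x y × BranchAlong G y x

branchEdge? : Decidable BranchEdge
branchEdge? G = any? λ x → any? λ y →
  T? (adj G x y) ×-dec along? x y ×-dec along? y x
  where
  along? : ∀ x y → Dec (BranchAlong G x y)
  along? x y = any? λ a → any? λ b →
    T? (adj G x a) ×-dec ¬? (a ≟ y) ×-dec T? (adj G x b) ×-dec ¬? (b ≟ y) ×-dec ¬? (a ≟ b)

BranchEdge-≼ : ∀ G H → G ≼ H → BranchEdge G → BranchEdge H
BranchEdge-≼ G H (f , f-inj , f-adj) (x , y , x~y , x-along , y-along) =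
  f x , f y , f-~ x~y , f-along x-along , f-along y-along
  where
  f-~ : ∀ {u v} → _~_ G u v → _~_ H (f u) (f v)
  f-~ {u} {v} = subst T (sym (f-adj u v))

  f-along : ∀ {u v} → BranchAlong G u v → BranchAlong H (f u) (f v)
  f-along (a , b , u~a , a≢v , u~b , b≢v , a≢b) =
    f a , f b , f-~ u~a , a≢v ∘ f-inj , f-~ u~b , b≢v ∘ f-inj , a≢b ∘ f-inj

doubleStar⋠stretched : ¬ (doubleStar ≼ stretchedDoubleStar)
doubleStar⋠stretched D≼E = from-no (branchEdge? stretchedDoubleStar)
  (BranchEdge-≼ doubleStar stretchedDoubleStar D≼E (from-yes (branchEdge? doubleStar)))

-- Proper induced subgraphs of the double star

-- This expresses that `φ` embeds `G` minus `w` into `K`, without constructing the vertex-deleted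
-- graph and renumbering its vertices.
EmbedsOff : (G : Graph) → Vertex G → (K : Graph) → (Vertex G → Vertex K) → Set
EmbedsOff G w K φ = ∀ x y → x ≢ w → y ≢ w →
  (φ x ≡ φ y → x ≡ y) × adj K (φ x) (φ y) ≡ adj G x y

embedsOff? : ∀ G w K φ → Dec (EmbedsOff G w K φ)
embedsOff? G w K φ = all? λ x → all? λ y →
  ¬? (x ≟ w) →-dec (¬? (y ≟ w) →-dec
    (((φ x ≟ φ y) →-dec (x ≟ y)) ×-dec (adj K (φ x) (φ y) ≟ᵇ adj G x y)))

≼-off : ∀ H G K {w} ((f , _) : H ≼ G) → (∀ x → f x ≢ w) →
        ∃ (EmbedsOff G w K) → H ≼ K
≼-off H G K (f , f-inj , f-adj) missed (φ , φ-emb) =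
  φ ∘ f ,
  f-inj ∘ proj₁ (φ-emb _ _ (missed _) (missed _)) ,
  λ u v → trans (proj₂ (φ-emb _ _ (missed u) (missed v))) (f-adj u v)

-- The deleted vertex w gets an arbitrary image.
doubleStar-deletions : ∀ w → ∃ (EmbedsOff doubleStar w K₁,₃⁺) ⊎
                             ∃ (EmbedsOff doubleStar w (2 · P 1 ⊕ P 3))
doubleStar-deletions = λ where
    0F → inj₁ (_ , from-yes (embedsOff? D 0F K (lookup (0F ∷ 3F ∷ 4F ∷ 1F ∷ 0F ∷ 2F ∷ []))))
    1F → inj₁ (_ , from-yes (embedsOff? D 1F K (lookup (3F ∷ 0F ∷ 2F ∷ 0F ∷ 1F ∷ 4F ∷ []))))
    2F → inj₁ (_ , from-yes (embedsOff? D 2F K (lookup (3F ∷ 2F ∷ 0F ∷ 0F ∷ 1F ∷ 4F ∷ []))))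
    3F → inj₂ (_ , from-yes (embedsOff? D 3F L (lookup (2F ∷ 0F ∷ 1F ∷ 0F ∷ 3F ∷ 4F ∷ []))))
    4F → inj₂ (_ , from-yes (embedsOff? D 4F L (lookup (0F ∷ 2F ∷ 4F ∷ 3F ∷ 0F ∷ 1F ∷ []))))
    5F → inj₁ (_ , from-yes (embedsOff? D 5F K (lookup (2F ∷ 3F ∷ 4F ∷ 1F ∷ 0F ∷ 0F ∷ []))))
  where
  D = doubleStar
  K = K₁,₃⁺
  L = 2 · P 1 ⊕ P 3

≼-surjective : ∀ H G ((f , _) : H ≼ G) → (∀ y → ∃[ x ] f x ≡ y) → G ≼ H
≼-surjective H G (f , f-inj , f-adj) onto =
  g , (λ {u} {v} gu≡gv → trans (sym (fg u)) (trans (cong f gu≡gv) (fg v))) ,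
  λ u v → trans (sym (f-adj (g u) (g v))) (cong₂ (adj G) (fg u) (fg v))
  where
  g : Vertex G → Vertex H
  g = proj₁ ∘ onto

  fg : ∀ y → f (g y) ≡ y
  fg = proj₂ ∘ onto

-- An embedding that misses a vertex factors through a vertex-deleted subgraph; one that misses none
-- is an isomorphism, whose inverse embeds the double star in `H`.
≼doubleStar : ∀ H → H ≼ doubleStar → ¬ (doubleStar ≼ H) →
              H ≼ K₁,₃⁺ ⊎ H ≼ 2 · P 1 ⊕ P 3
≼doubleStar H H≼D@(f , _) D⋠H with any? (λ w → all? λ x → ¬? (f x ≟ w))
... | yes (w , missed) =
  map (≼-off H doubleStar K₁,₃⁺ H≼D missed)
      (≼-off H doubleStar (2 · P 1 ⊕ P 3) H≼D missed)
      (doubleStar-deletions w)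
... | no ¬missed = contradiction (≼-surjective H doubleStar H≼D onto) D⋠H
  where
  onto : ∀ y → ∃[ x ] f x ≡ y
  onto y = decidable-stable (any? λ x → f x ≟ y)
    λ ¬x → ¬missed (y , λ x fx≡y → ¬x (x , fx≡y))

theorem2 : (H : Graph) → IVCIdentical (FreeBipartite H) ⇔ (H ≼ K₁,₃⁺ ⊎ H ≼ 2 · P 1 ⊕ P 3)
theorem2 H = mk⇔ necessary sufficient
  where
  module _ (identical : IVCIdentical (FreeBipartite H)) where

    contained : ∀ G → ivc G ≢ vc G → H ≼ proj₁ G
    contained 𝔾@(G , _) ivc≢vc =
      decidable-stable (H ≼? G) λ H⋠G → ivc≢vc (identical 𝔾 H⋠G)

    necessary : H ≼ K₁,₃⁺ ⊎ H ≼ 2 · P 1 ⊕ P 3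
    -- `H` also lies in the stretched double star, so a double star inside `H` would lie there too.
    necessary = ≼doubleStar H (contained doubleStarᵇ doubleStar-ivc≢vc) λ D≼H →
      doubleStar⋠stretched (≼-trans doubleStar H stretchedDoubleStar D≼H
        (contained stretchedDoubleStarᵇ stretchedDoubleStar-ivc≢vc))

  sufficient : H ≼ K₁,₃⁺ ⊎ H ≼ 2 · P 1 ⊕ P 3 → IVCIdentical (FreeBipartite H)
  sufficient H≼ 𝔾@(G , _) H⋠G = ivc≡vc 𝔾
    (map (free K₁,₃⁺) (free (2 · P 1 ⊕ P 3)) H≼)
    where
    free : ∀ K → H ≼ K → Free K G
    free K H≼K K≼G = H⋠G (≼-trans H K G H≼K K≼G)
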